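{- Let $j$ be a positive integer, $\sigma_j=p_1+p_2+\dots+p_j$ and $N_j=p_1p_2\cdots p_j$, where $p_i$ denotes the $i$-th prime. Then $h(\sigma_j)=N_j$.
   Context: For an integer $n\ge0$, $h(n)$ is the maximum of all squarefree positive integers $M$ such that the sum $\ell(M)$ of the prime factors of $M$ satisfies $\ell(M)\le n$ (with $\ell(1)=0$); i.e. $h(n)$ is the greatest product of a family of distinct primes whose sum does not exceed $n$. -}

module Defs where

open import Data.List.Base using (List; []; _∷_)
open import Data.List.Relation.Unary.All using (_∷_)
open import Data.Nat.Base
open import Data.Nat.Divisibility
open import Data.Nat.Induction using (<-rec)
open import Data.Nat.ListAction using (sum; product)
open import Data.Nat.Primality using (Prime; prime?; ¬prime[1])
open import Data.Nat.Primality.Factorisation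
open import Data.Nat.Properties
open import Data.Product.Base using (∃; _×_; _,_; proj₁; proj₂)
open import Level using (0ℓ)
open import Relation.Binary.PropositionalEquality
open import Relation.Nullary using (Dec; yes; no; contradiction)
open import Relation.Nullary.Decidable using (map′; _×-dec_; _→-dec_)
open import Relation.Unary using (Pred; Decidable)

IsMinimum : Pred ℕ 0ℓ → Pred ℕ 0ℓ
IsMinimum P m = P m × (∀ k → P k → m ≤ k)

IsMaximum : Pred ℕ 0ℓ → Pred ℕ 0ℓ
IsMaximum P m = P m × (∀ k → P k → k ≤ m)

minimum : {P : Pred ℕ 0ℓ} → Decidable P → ∃ P → ∃ (IsMinimum P)
minimum {P} P? (n , pn) = <-rec (λ n → P n → ∃ (IsMinimum P)) step n pn
  where
  step : ∀ n → (∀ {m} → m < n → P m → ∃ (IsMinimum P)) → P n → ∃ (IsMinimum P)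
  step n rec pn with anyUpTo? P? n
  ... | yes (m , m<n , pm) = rec m<n pm
  ... | no none = n , pn , λ k pk → ≮⇒≥ λ k<n → none (k , k<n , pk)

maximum : {P : Pred ℕ 0ℓ} → Decidable P → ∃ P → ∀ b → (∀ k → P k → k ≤ b) → ∃ (IsMaximum P)
maximum {P} P? (n , pn) zero bound =
  0 , subst P (n≤0⇒n≡0 (bound n pn)) pn , bound
maximum {P} P? w (suc b) bound with P? (suc b)
... | yes pb = suc b , pb , bound
... | no ¬pb = maximum P? w b λ k pk →
  s≤s⁻¹ (≤∧≢⇒< (bound k pk) λ k≡ → ¬pb (subst P k≡ pk))

LargerPrime : ℕ → Pred ℕ 0ℓ
LargerPrime n q = Prime q × n < q

primeFactor : ∀ n → .{{NonTrivial n}} → ∃ λ q → Prime q × q ∣ n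
primeFactor n@(2+ _) with factorise n
... | record { factors = [] ; isFactorisation = () }
... | record { factors = q ∷ qs ; isFactorisation = eq ; factorsPrime = pq ∷ _ } =
  q , pq , divides (product qs) (trans eq (*-comm q (product qs)))

largerPrime : ∀ n → ∃ (LargerPrime n)
largerPrime n with primeFactor (suc (n !)) {{n>1⇒nonTrivial (s≤s (1≤n! n))}}
... | q , pq , q∣1+n! = q , pq , ≰⇒> λ q≤n →
  ¬prime[1] (subst Prime (∣1⇒≡1 (∣m+n∣m⇒∣n (subst (q ∣_) (+-comm 1 (n !)) q∣1+n!) (q∣n! q pq q≤n))) pq)
  where
  q∣n! : ∀ q → Prime q → q ≤ n → q ∣ n !
  q∣n! (suc q) _ q≤n = ∣-trans (m∣m*n (q !)) (m≤n⇒m!∣n! q≤n)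

leastLargerPrime : ∀ n → ∃ (IsMinimum (LargerPrime n))
leastLargerPrime n = minimum (λ q → prime? q ×-dec n <? q) (largerPrime n)

nextPrime : ℕ → ℕ
nextPrime n = proj₁ (leastLargerPrime n)

-- The i-th prime, indexed from 1.
p : (i : ℕ) → .{{NonZero i}} → ℕ
p 1      = 2
p (2+ i) = nextPrime (p (suc i))

σ : ℕ → ℕ
σ zero    = 0
σ (suc j) = σ j + p (suc j)

N : ℕ → ℕ
N zero    = 1
N (suc j) = N j * p (suc j)

Squarefree : Pred ℕ 0ℓ
Squarefree M = ∀ d → d * d ∣ M → d ≡ 1

-- Prime factors are summed with multiplicity; ℓ is only used at squarefree M,
-- where all multiplicities are 1.
ℓ : (M : ℕ) → .{{NonZero M}} → ℕ
ℓ M = sum (factors (factorise M))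

record Admissible (n M : ℕ) : Set where
  field
    .{{positive}} : NonZero M
    squarefree    : Squarefree M
    ℓ≤n           : ℓ M ≤ n

squarefree? : ∀ M → .{{NonZero M}} → Dec (Squarefree M)
squarefree? M = map′
  (λ below d d²∣M → below (s≤s (∣⇒≤ (∣-trans (m∣m*n d) d²∣M))) d²∣M)
  (λ sf {d} _ → sf d)
  (allUpTo? (λ d → (d * d ∣? M) →-dec (d ≟ 1)) (suc M))

admissible? : ∀ n → Decidable (Admissible n)
admissible? n zero = no λ a → contradiction (Admissible.squarefree a 0 (divides 0 refl)) λ ()
admissible? n M@(suc _) = map′
  (λ (sf , ℓ≤n) → record { squarefree = sf ; ℓ≤n = ℓ≤n })
  (λ a → Admissible.squarefree a , Admissible.ℓ≤n a)
  (squarefree? M ×-dec (ℓ M ≤? n))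

1-admissible : ∀ n → Admissible n 1
1-admissible n = record
  { squarefree = λ d d²∣1 → m*n≡1⇒m≡1 d d (∣1⇒≡1 d²∣1)
  ; ℓ≤n = z≤n
  }

n≤2^n : ∀ n → n ≤ 2 ^ n
n≤2^n zero    = z≤n
n≤2^n (suc n) = ≤-trans (+-mono-≤ (m^n>0 2 n) (n≤2^n n)) (+-monoʳ-≤ (2 ^ n) (m≤m+n (2 ^ n) 0))

product≤2^sum : ∀ xs → product xs ≤ 2 ^ sum xs
product≤2^sum []       = ≤-refl
product≤2^sum (x ∷ xs) = ≤-trans
  (*-mono-≤ (n≤2^n x) (product≤2^sum xs))
  (≤-reflexive (sym (^-distribˡ-+-* 2 x (sum xs))))

admissible≤2^n : ∀ n M → Admissible n M → M ≤ 2 ^ n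
admissible≤2^n n zero      a = z≤n
admissible≤2^n n M@(suc _) a = begin
  M                                ≡⟨ PrimeFactorisation.isFactorisation (factorise M) ⟩
  product (factors (factorise M))  ≤⟨ product≤2^sum (factors (factorise M)) ⟩
  2 ^ ℓ M                          ≤⟨ ^-monoʳ-≤ 2 (Admissible.ℓ≤n a) ⟩
  2 ^ n                            ∎
  where open ≤-Reasoning

greatestAdmissible : ∀ n → ∃ (IsMaximum (Admissible n))
greatestAdmissible n = maximum (admissible? n) (1 , 1-admissible n) (2 ^ n) (admissible≤2^n n)

h : ℕ → ℕ
h n = proj₁ (greatestAdmissible n)

{-# OPTIONS --safe #-}

-- Fix q ≥ 4. Since x^(1/x) decreases for x ≥ 3 and 4^(1/4) = 2^(1/2), we have
-- q^a ≤ a^q for 2 ≤ a ≤ q and b^q ≤ q^b for b ≥ q. Choose q just above p_j and let B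
-- be the set of prime factors of an admissible M. Elements common to B and
-- A = {p_1, …, p_j} contribute equally to both sides of
--   (∏ B)^q q^(∑ A) ≤ (∏ A)^q q^(∑ B),
-- and every other element helps, so ∑ B ≤ ∑ A forces ∏ B ≤ ∏ A.
module Submission where

import Algebra.Properties.CommutativeSemigroup as CommutativeSemigroupProperties
open import Data.List.Base using (List; []; _∷_; _++_)
open import Data.List.Membership.DecPropositional using (_∈?_)
open import Data.List.Membership.Propositional using (_∈_)
open import Data.List.Membership.Propositional.Properties using (∈-∃++)
open import Data.List.Relation.Binary.Permutation.Propositional
  using (_↭_; ↭-reflexive; ↭-sym; ↭-trans; ↭⇒↭ₛ)
open import Data.List.Relation.Binary.Permutation.Propositional.Properties
  using (All-resp-↭; ∈-resp-↭; shift)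
import Data.List.Relation.Binary.Permutation.Setoid.Properties as ↭ₛ
open import Data.List.Relation.Unary.All as All using (All; []; _∷_)
open import Data.List.Relation.Unary.AllPairs using ([]; _∷_)
open import Data.List.Relation.Unary.Any using (here; there)
open import Data.List.Relation.Unary.Unique.Propositional using (Unique)
open import Data.Nat.Base
open import Data.Nat.Divisibility
open import Data.Nat.ListAction using (sum; product)
open import Data.Nat.ListAction.Properties using (sum-↭; product-↭; ∈⇒∣product)
open import Data.Nat.Primality
  using (Prime; prime⇒nonZero; prime⇒nonTrivial; prime[2]; ¬prime[1]; productOfPrimes≢0)
open import Data.Nat.Primality.Factorisation
open import Data.Nat.Properties
open import Data.Nat.Tactic.RingSolver using (solve-∀)
open import Data.Product.Base using (∃; _,_; proj₁; proj₂)
open import Data.Sum.Base using (_⊎_; inj₁; inj₂)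
open import Relation.Binary.PropositionalEquality
open import Relation.Nullary using (yes; no; contradiction)
open import Defs

open CommutativeSemigroupProperties *-commutativeSemigroup using (x∙yz≈y∙xz)
open PrimeFactorisation using (isFactorisation; factorsPrime)

-- Comparison of `q ^ a` with `a ^ q`

^-distribʳ-* : ∀ k m n → (m * n) ^ k ≡ m ^ k * n ^ k
^-distribʳ-* zero    m n = refl
^-distribʳ-* (suc k) m n = trans
  (cong (m * n *_) (^-distribʳ-* k m n))
  ([m*n]*[o*p]≡[m*o]*[n*p] m n (m ^ k) (n ^ k))

^-cancelˡ-≤ : ∀ k .{{_ : NonZero k}} {m n} → m ^ k ≤ n ^ k → m ≤ n
^-cancelˡ-≤ k m^k≤n^k = ≮⇒≥ λ n<m → <⇒≱ (^-monoˡ-< k n<m) m^k≤n^k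

-- The bound (1 + x)^k ≤ 1 + kx + (kx)² at x = 1/n, valid while kx ≤ 1.
[1+n]^k-bound : ∀ {k n} → k ≤ n → n * n * suc n ^ k ≤ (n * n + k * n + k * k) * n ^ k
[1+n]^k-bound {zero}  {n} _ =
  *-monoˡ-≤ 1 (≤-trans (m≤m+n (n * n) 0) (m≤m+n (n * n + 0) 0))
[1+n]^k-bound {suc k} {n} k<n = begin
  n * n * (suc n * suc n ^ k)                             ≡⟨ x∙yz≈y∙xz (n * n) (suc n) (suc n ^ k) ⟩
  suc n * (n * n * suc n ^ k)                             ≤⟨ *-monoʳ-≤ (suc n) ([1+n]^k-bound (<⇒≤ k<n)) ⟩
  suc n * ((n * n + k * n + k * k) * n ^ k)               ≡⟨ *-assoc (suc n) (n * n + k * n + k * k) (n ^ k) ⟨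
  suc n * (n * n + k * n + k * k) * n ^ k                 ≤⟨ *-monoˡ-≤ (n ^ k) coefficient ⟩
  (n * n + suc k * n + suc k * suc k) * n * n ^ k         ≡⟨ *-assoc (n * n + suc k * n + suc k * suc k) n (n ^ k) ⟩
  (n * n + suc k * n + suc k * suc k) * (n * n ^ k)       ∎
  where
  open ≤-Reasoning
  -- The terms shared by both expanded polynomials. What is left over is `k * k` on the left and
  -- `k * n + n` on the right, and `k ≤ n` compares these.
  common : ℕ
  common = n * n * n + k * n * n + k * k * n + n * n + k * n
  expandˡ : ∀ n k → suc n * (n * n + k * n + k * k) ≡
            n * n * n + k * n * n + k * k * n + n * n + k * n + k * k
  expandˡ = solve-∀
  expandʳ : ∀ n k → n * n * n + k * n * n + k * k * n + n * n + k * n + (k * n + n) ≡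
            (n * n + suc k * n + suc k * suc k) * n
  expandʳ = solve-∀
  coefficient : suc n * (n * n + k * n + k * k) ≤ (n * n + suc k * n + suc k * suc k) * n
  coefficient = begin
    suc n * (n * n + k * n + k * k)         ≡⟨ expandˡ n k ⟩
    common + k * k                          ≤⟨ +-monoʳ-≤ common (≤-trans (*-monoʳ-≤ k (<⇒≤ k<n)) (m≤m+n (k * n) n)) ⟩
    common + (k * n + n)                    ≡⟨ expandʳ n k ⟩
    (n * n + suc k * n + suc k * suc k) * n ∎

-- For `k ≤ n` the terms 1, k/n and (k/n)² of the previous bound are each at most 1. The constant 3
-- is small enough for the induction in `n^m≤m^n` to start from base 3.
[1+n]^k≤3n^k : ∀ {k n} → k ≤ n → suc n ^ k ≤ 3 * n ^ k
[1+n]^k≤3n^k {zero}          _   = s≤s z≤n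
[1+n]^k≤3n^k {suc k} {suc n} k≤n = *-cancelˡ-≤ (m * m) (begin
  m * m * suc m ^ l                    ≤⟨ [1+n]^k-bound k≤n ⟩
  (m * m + l * m + l * l) * m ^ l      ≤⟨ *-monoˡ-≤ (m ^ l) (+-mono-≤ (+-monoʳ-≤ (m * m) (*-monoˡ-≤ m k≤n)) (*-mono-≤ k≤n k≤n)) ⟩
  (m * m + m * m + m * m) * m ^ l      ≡⟨ collect (m * m) (m ^ l) ⟩
  m * m * (3 * m ^ l)                  ∎)
  where
  open ≤-Reasoning
  m l : ℕ
  m = suc n
  l = suc k
  collect : ∀ s t → (s + s + s) * t ≡ s * (3 * t)
  collect = solve-∀

-- Induction on `n` from the equality at `n = m`: a step from `n` to `suc n` multiplies the left
-- side by at most 3 and the right side by `m`, which is at least 3.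
n^m≤m^n : ∀ {m n} → 3 ≤ m → m ≤ n → n ^ m ≤ m ^ n
n^m≤m^n {m} 3≤m m≤n = go (≤⇒≤′ m≤n)
  where
  go : ∀ {n} → m ≤′ n → n ^ m ≤ m ^ n
  go ≤′-refl       = ≤-refl
  go (≤′-step m≤n) = ≤-trans ([1+n]^k≤3n^k (≤′⇒≤ m≤n)) (*-mono-≤ 3≤m (go m≤n))

-- Base 2 lies outside the range of `n^m≤m^n`. The induction starts at 4, where both sides equal 16.
n^2≤2^n : ∀ {n} → 4 ≤ n → n ^ 2 ≤ 2 ^ n
n^2≤2^n 4≤n = go (≤⇒≤′ 4≤n)
  where
  doubling : ∀ {n} → 4 ≤ n → suc n ^ 2 ≤ 2 * n ^ 2
  doubling (s≤s (s≤s (s≤s (s≤s {n = d} _)))) =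
    -- With `n = 4 + d`, the added polynomial is the difference 2n² - (n + 1)², whose coefficients
    -- are all nonnegative.
    ≤-trans (m≤m+n ((5 + d) ^ 2) (d * d + 6 * d + 7)) (≤-reflexive (identity d))
    where
    identity : ∀ d → (5 + d) * ((5 + d) * 1) + (d * d + 6 * d + 7) ≡ 2 * ((4 + d) * ((4 + d) * 1))
    identity = solve-∀
  go : ∀ {n} → 4 ≤′ n → n ^ 2 ≤ 2 ^ n
  go ≤′-refl       = ≤-refl
  go (≤′-step 4≤n) = ≤-trans (doubling (≤′⇒≤ 4≤n)) (*-monoʳ-≤ 2 (go 4≤n))

q^a≤a^q : ∀ {a q} → 4 ≤ q → 2 ≤ a → a ≤ q → q ^ a ≤ a ^ q
q^a≤a^q 4≤q 2≤a a≤q with m≤n⇒m<n∨m≡n 2≤a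
... | inj₁ 3≤a  = n^m≤m^n 3≤a a≤q
... | inj₂ refl = n^2≤2^n 4≤q

-- The exchange inequality for lists without repetition

∈⇒↭∷ : ∀ {x : ℕ} {xs} → x ∈ xs → ∃ λ ys → xs ↭ x ∷ ys
∈⇒↭∷ {x} x∈xs with ys , zs , eq ← ∈-∃++ x∈xs =
  ys ++ zs , ↭-trans (↭-reflexive eq) (shift x ys zs)

Unique-resp-↭ : ∀ {xs ys : List ℕ} → xs ↭ ys → Unique xs → Unique ys
Unique-resp-↭ xs↭ys = ↭ₛ.Unique-resp-↭ (setoid ℕ) (↭⇒↭ₛ xs↭ys)

∈⇒≤sum : ∀ {x xs} → x ∈ xs → x ≤ sum xs
∈⇒≤sum {xs = x ∷ xs} (here refl)  = m≤m+n x (sum xs)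
∈⇒≤sum {xs = y ∷ xs} (there x∈xs) = ≤-trans (∈⇒≤sum x∈xs) (m≤n+m (sum xs) y)

product^q≤q^sum : ∀ q {bs} → All (λ b → b ^ q ≤ q ^ b) bs → product bs ^ q ≤ q ^ sum bs
product^q≤q^sum q {[]}     []           = ≤-reflexive (^-zeroˡ q)
product^q≤q^sum q {b ∷ bs} (b≤ ∷ bs≤) = begin
  (b * product bs) ^ q    ≡⟨ ^-distribʳ-* q b (product bs) ⟩
  b ^ q * product bs ^ q  ≤⟨ *-mono-≤ b≤ (product^q≤q^sum q bs≤) ⟩
  q ^ b * q ^ sum bs      ≡⟨ ^-distribˡ-+-* q b (sum bs) ⟨
  q ^ (b + sum bs)        ∎
  where open ≤-Reasoning

-- Induction on `as`. A head missing from `bs` costs `q ^ a` on the left and gains `a ^ q` on the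
-- right; a head present in `bs` is removed from both lists. Once `as` is empty, every remaining `b`
-- satisfies `b ^ q ≤ q ^ b`.
exchange : ∀ q {as bs} → All (λ a → q ^ a ≤ a ^ q) as → Unique bs →
           (∀ {b} → b ∈ bs → b ∈ as ⊎ b ^ q ≤ q ^ b) →
           product bs ^ q * q ^ sum as ≤ product as ^ q * q ^ sum bs
exchange q {[]} {bs} [] _ outside = begin
  product bs ^ q * 1   ≡⟨ *-identityʳ _ ⟩
  product bs ^ q       ≤⟨ product^q≤q^sum q (All.tabulate λ b∈bs → large (outside b∈bs)) ⟩
  q ^ sum bs           ≡⟨ *-identityˡ _ ⟨
  1 * q ^ sum bs       ≡⟨ cong (_* q ^ sum bs) (^-zeroˡ q) ⟨
  1 ^ q * q ^ sum bs   ∎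
  where
  open ≤-Reasoning
  large : ∀ {b} → b ∈ [] ⊎ b ^ q ≤ q ^ b → b ^ q ≤ q ^ b
  large (inj₂ b^q≤q^b) = b^q≤q^b
exchange q {a ∷ as} {bs} (q^a≤a^q ∷ small) unique outside with _∈?_ _≟_ a bs
... | no a∉bs = begin
  product bs ^ q * q ^ (a + sum as)            ≡⟨ cong (product bs ^ q *_) (^-distribˡ-+-* q a (sum as)) ⟩
  product bs ^ q * (q ^ a * q ^ sum as)        ≡⟨ x∙yz≈y∙xz (product bs ^ q) (q ^ a) (q ^ sum as) ⟩
  q ^ a * (product bs ^ q * q ^ sum as)        ≤⟨ *-mono-≤ q^a≤a^q (exchange q small unique outside′) ⟩
  a ^ q * (product as ^ q * q ^ sum bs)        ≡⟨ *-assoc (a ^ q) _ _ ⟨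
  a ^ q * product as ^ q * q ^ sum bs          ≡⟨ cong (_* q ^ sum bs) (^-distribʳ-* q a (product as)) ⟨
  (a * product as) ^ q * q ^ sum bs            ∎
  where
  open ≤-Reasoning
  outside′ : ∀ {b} → b ∈ bs → b ∈ as ⊎ b ^ q ≤ q ^ b
  outside′ b∈bs with outside b∈bs
  ... | inj₁ (here refl)  = contradiction b∈bs a∉bs
  ... | inj₁ (there b∈as) = inj₁ b∈as
  ... | inj₂ b^q≤q^b      = inj₂ b^q≤q^b
... | yes a∈bs with bs′ , bs↭a∷bs′ ← ∈⇒↭∷ a∈bs
    with a∉bs′ ∷ unique′ ← Unique-resp-↭ bs↭a∷bs′ unique = begin
  product bs ^ q * q ^ (a + sum as)                 ≡⟨ cong (λ x → x ^ q * q ^ (a + sum as)) (product-↭ bs↭a∷bs′) ⟩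
  (a * product bs′) ^ q * q ^ (a + sum as)          ≡⟨ factor (product bs′) (sum as) ⟩
  a ^ q * q ^ a * (product bs′ ^ q * q ^ sum as)    ≤⟨ *-monoʳ-≤ (a ^ q * q ^ a) (exchange q small unique′ outside′) ⟩
  a ^ q * q ^ a * (product as ^ q * q ^ sum bs′)    ≡⟨ factor (product as) (sum bs′) ⟨
  (a * product as) ^ q * q ^ (a + sum bs′)          ≡⟨ cong (λ x → (a * product as) ^ q * q ^ x) (sum-↭ bs↭a∷bs′) ⟨
  (a * product as) ^ q * q ^ sum bs                 ∎
  where
  open ≤-Reasoning
  factor : ∀ P S → (a * P) ^ q * q ^ (a + S) ≡ a ^ q * q ^ a * (P ^ q * q ^ S)
  factor P S = trans
    (cong₂ _*_ (^-distribʳ-* q a P) (^-distribˡ-+-* q a S))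
    ([m*n]*[o*p]≡[m*o]*[n*p] (a ^ q) (P ^ q) (q ^ a) (q ^ S))
  outside′ : ∀ {b} → b ∈ bs′ → b ∈ as ⊎ b ^ q ≤ q ^ b
  outside′ b∈bs′ with outside (∈-resp-↭ (↭-sym bs↭a∷bs′) (there b∈bs′))
  -- Since `bs` has no repetition, `a` is absent from `bs′`, so dropping it from `as` loses nothing.
  ... | inj₁ (here refl)  = contradiction refl (All.lookup a∉bs′ b∈bs′)
  ... | inj₁ (there b∈as) = inj₁ b∈as
  ... | inj₂ b^q≤q^b      = inj₂ b^q≤q^b

-- The sum hypothesis bounds `q ^ sum bs` by `q ^ sum as` in the exchange inequality; this power
-- then cancels, and q-th roots are taken.
product-≤ : ∀ q .{{_ : NonZero q}} {as bs} → All (λ a → q ^ a ≤ a ^ q) as → Unique bs →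
            (∀ {b} → b ∈ bs → b ∈ as ⊎ b ^ q ≤ q ^ b) →
            sum bs ≤ sum as → product bs ≤ product as
product-≤ q {as} {bs} small unique outside Σbs≤Σas =
  ^-cancelˡ-≤ q (*-cancelʳ-≤ _ _ (q ^ sum as) {{m^n≢0 q (sum as)}}
    (≤-trans (exchange q small unique outside)
             (*-monoʳ-≤ (product as ^ q) (^-monoʳ-≤ q Σbs≤Σas))))

-- Squarefree numbers as products of distinct primes

prime⇒≥2 : ∀ {n} → Prime n → 2 ≤ n
prime⇒≥2 {n} pr = nonTrivial⇒n>1 n {{prime⇒nonTrivial pr}}

-- If the head `x` recurred in the tail, `x * x` would divide the product and force `x ≡ 1`.
squarefree⇒unique : ∀ {xs} → All Prime xs → Squarefree (product xs) → Unique xs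
squarefree⇒unique {[]}     []            _  = []
squarefree⇒unique {x ∷ xs} (prx ∷ prxs) sf =
  All.tabulate (λ where
    y∈xs refl → ¬prime[1] (subst Prime (sf x (*-monoʳ-∣ x (∈⇒∣product y∈xs))) prx))
  ∷ squarefree⇒unique prxs λ d d²∣Πxs → sf d (∣n⇒∣m*n x d²∣Πxs)

-- If `d ≥ 2` and `d * d` divides the product, so does `r * r` for a prime factor `r` of `d`. Then
-- `r` is an entry, and after one `r` is cancelled it still divides the product of the others, so it
-- is an entry twice.
unique⇒squarefree : ∀ {xs} → All Prime xs → Unique xs → Squarefree (product xs)
unique⇒squarefree prs unique zero 0∣Πxs =
  contradiction (0∣⇒≡0 0∣Πxs) (≢-nonZero⁻¹ _ {{productOfPrimes≢0 prs}})
unique⇒squarefree prs unique 1 _ = refl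
unique⇒squarefree {xs} prs unique d@(2+ _) d²∣Πxs
  with r , pr , r∣d ← primeFactor d
  with r²∣Πxs ← ∣-trans (*-pres-∣ r∣d r∣d) d²∣Πxs
  with ys , xs↭r∷ys ← ∈⇒↭∷ (factorisationHasAllPrimeFactors pr (∣-trans (m∣m*n r) r²∣Πxs) prs)
  with r∉ys ∷ _ ← Unique-resp-↭ xs↭r∷ys unique
  with _ ∷ prys ← All-resp-↭ xs↭r∷ys prs =
  contradiction refl (All.lookup r∉ys (factorisationHasAllPrimeFactors pr r∣Πys prys))
  where
  r∣Πys : r ∣ product ys
  r∣Πys = *-cancelˡ-∣ r {{prime⇒nonZero pr}} (subst (r * r ∣_) (product-↭ xs↭r∷ys) r²∣Πxs)

-- The list of the first primes

nextPrime-minimum : ∀ n → IsMinimum (LargerPrime n) (nextPrime n)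
nextPrime-minimum n = proj₂ (leastLargerPrime n)

p-prime : ∀ j → Prime (p (suc j))
p-prime zero    = prime[2]
p-prime (suc j) = proj₁ (proj₁ (nextPrime-minimum (p (suc j))))

p-< : ∀ j → p (suc j) < p (2+ j)
p-< j = proj₂ (proj₁ (nextPrime-minimum (p (suc j))))

firstPrimes : ℕ → List ℕ
firstPrimes zero    = []
firstPrimes (suc j) = p (suc j) ∷ firstPrimes j

sum-firstPrimes : ∀ j → sum (firstPrimes j) ≡ σ j
sum-firstPrimes zero    = refl
sum-firstPrimes (suc j) = trans (cong (p (suc j) +_) (sum-firstPrimes j)) (+-comm (p (suc j)) (σ j))

product-firstPrimes : ∀ j → product (firstPrimes j) ≡ N j
product-firstPrimes zero    = refl
product-firstPrimes (suc j) = trans (cong (p (suc j) *_) (product-firstPrimes j)) (*-comm (p (suc j)) (N j))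

firstPrimes-prime : ∀ j → All Prime (firstPrimes j)
firstPrimes-prime zero    = []
firstPrimes-prime (suc j) = p-prime j ∷ firstPrimes-prime j

firstPrimes-< : ∀ j → All (_< p (suc j)) (firstPrimes j)
firstPrimes-< zero    = []
firstPrimes-< (suc j) = p-< j ∷ All.map (λ x<p → <-trans x<p (p-< j)) (firstPrimes-< j)

firstPrimes-≤ : ∀ j → All (_≤ p (suc j)) (firstPrimes (suc j))
firstPrimes-≤ j = ≤-refl ∷ All.map <⇒≤ (firstPrimes-< j)

firstPrimes-unique : ∀ j → Unique (firstPrimes j)
firstPrimes-unique zero    = []
firstPrimes-unique (suc j) = All.map >⇒≢ (firstPrimes-< j) ∷ firstPrimes-unique j

-- Descent on `j`: no prime lies strictly between consecutive values of `p`, because `nextPrime` is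
-- a minimum.
prime≤p⇒∈firstPrimes : ∀ j {b} → Prime b → b ≤ p (suc j) → b ∈ firstPrimes (suc j)
prime≤p⇒∈firstPrimes j prb b≤p with m≤n⇒m<n∨m≡n b≤p
... | inj₂ b≡p = here b≡p
prime≤p⇒∈firstPrimes zero    prb b≤p | inj₁ b<2 = contradiction (prime⇒≥2 prb) (<⇒≱ b<2)
prime≤p⇒∈firstPrimes (suc j) prb b≤p | inj₁ b<p = there (prime≤p⇒∈firstPrimes j prb
  (≮⇒≥ λ p<b → <⇒≱ b<p (proj₂ (nextPrime-minimum (p (suc j))) _ (prb , p<b))))

-- Admissibility and maximality of `N j`

N-admissible : ∀ j → Admissible (σ j) (N j)
N-admissible j = record
  { positive   = N≢0
  ; squarefree = subst Squarefree (product-firstPrimes j)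
                   (unique⇒squarefree (firstPrimes-prime j) (firstPrimes-unique j))
  -- `ℓ` reads the list chosen by `factorise`; unique factorisation makes it a permutation of
  -- `firstPrimes j`.
  ; ℓ≤n        = ≤-reflexive (trans
                   (sum-↭ (factorisationUnique (factorise (N j) {{N≢0}}) factorisation))
                   (sum-firstPrimes j))
  }
  where
  factorisation : PrimeFactorisation (N j)
  factorisation = record
    { factors         = firstPrimes j
    ; isFactorisation = sym (product-firstPrimes j)
    ; factorsPrime    = firstPrimes-prime j
    }
  N≢0 : NonZero (N j)
  N≢0 = subst NonZero (product-firstPrimes j) (productOfPrimes≢0 (firstPrimes-prime j))

-- The gap hypothesis sorts the entries of `bs`: those up to `p (suc j)` are among the first primes,
-- and those from `q` on satisfy `b ^ q ≤ q ^ b`. Leaving `q` free allows for the smallest case,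
-- where the successor of 2 is below 4.
product-≤-N : ∀ j q → 4 ≤ q → p (suc j) ≤ q → ∀ {bs} → All Prime bs → Unique bs →
              (∀ {b} → b ∈ bs → b ≤ p (suc j) ⊎ q ≤ b) →
              sum bs ≤ σ (suc j) → product bs ≤ N (suc j)
product-≤-N j q 4≤q p≤q {bs} prbs unique gap Σbs≤σ =
  subst (product bs ≤_) (product-firstPrimes (suc j))
    (product-≤ q {{>-nonZero (≤-trans (s≤s z≤n) 4≤q)}} small unique outside
      (subst (sum bs ≤_) (sym (sum-firstPrimes (suc j))) Σbs≤σ))
  where
  small : All (λ a → q ^ a ≤ a ^ q) (firstPrimes (suc j))
  small = All.zipWith
    (λ (pra , a≤p) → q^a≤a^q 4≤q (prime⇒≥2 pra) (≤-trans a≤p p≤q))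
    (firstPrimes-prime (suc j) , firstPrimes-≤ j)
  outside : ∀ {b} → b ∈ bs → b ∈ firstPrimes (suc j) ⊎ b ^ q ≤ q ^ b
  outside b∈bs with gap b∈bs
  ... | inj₁ b≤p = inj₁ (prime≤p⇒∈firstPrimes j (All.lookup prbs b∈bs) b≤p)
  ... | inj₂ q≤b = inj₂ (n^m≤m^n (≤-trans (n≤1+n 3) 4≤q) q≤b)

sum≤σ⇒product≤N : ∀ j {bs} → All Prime bs → Unique bs → sum bs ≤ σ (suc j) → product bs ≤ N (suc j)
-- Here q = 4 leaves out the prime 3, which is too large to occur since σ 1 = 2.
sum≤σ⇒product≤N zero prbs unique Σbs≤2 =
  product-≤-N 0 4 ≤-refl (s≤s (s≤s z≤n)) prbs unique
    (λ b∈bs → inj₁ (≤-trans (∈⇒≤sum b∈bs) Σbs≤2)) Σbs≤2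
-- Now `q` is the successor of `p (2+ j)`, so every number satisfies the gap condition; `4 ≤ q`
-- holds because `p (2+ j)` exceeds a prime and is thus at least 3.
sum≤σ⇒product≤N (suc j) prbs unique Σbs≤σ =
  product-≤-N (suc j) (suc (p (2+ j)))
    (s≤s (≤-trans (s≤s (prime⇒≥2 (p-prime j))) (p-< j))) (n≤1+n _) prbs unique
    (λ {b} _ → ≤-<-connex b (p (2+ j))) Σbs≤σ

admissible⇒≤N : ∀ j M → Admissible (σ (suc j)) M → M ≤ N (suc j)
admissible⇒≤N j zero      _ = z≤n
admissible⇒≤N j M@(suc _) a = subst (_≤ N (suc j)) (sym (isFactorisation f))
  (sum≤σ⇒product≤N j (factorsPrime f)
    (squarefree⇒unique (factorsPrime f) (subst Squarefree (isFactorisation f) (Admissible.squarefree a)))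
    (Admissible.ℓ≤n a))
  where
  f : PrimeFactorisation M
  f = factorise M

proposition3p1 : (j : ℕ) → .{{_ : NonZero j}} → h (σ j) ≡ N j
proposition3p1 (suc j) with greatestAdmissible (σ (suc j))
... | m , m-admissible , m-greatest =
  ≤-antisym (admissible⇒≤N j m m-admissible) (m-greatest (N (suc j)) (N-admissible (suc j)))
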